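{- Let $\mathbb{V}$ be a vector space of finite dimension $n$ over a finite field $\mathbb{F}$ with $q$ elements, and let $\Gamma(\mathbb{V})$ be its non-zero component graph with respect to a basis $\{b_1,\ldots,b_n\}$. If $q\ge 3$, then the exchange property holds for locating-dominating sets in $\Gamma(\mathbb{V})$.
   Context: Non-zero component graph: given a finite-dimensional vector space $\mathbb{V}$ over $\mathbb{F}$ with basis $\{b_1,\ldots,b_n\}$ ($n\ge 1$), $\Gamma(\mathbb{V})$ is the simple graph whose vertices are the non-zero vectors of $\mathbb{V}$; two distinct vertices are adjacent if and only if there is some $b_i$ that has non-zero coefficient in the unique linear combinations (with respect to the basis) of both. For a graph $\Gamma$ and a vertex $u$, $N(u)$ is the set of vertices adjacent to $u$. A set $L_D\subseteq V(\Gamma)$ is a locating-dominating set for $\Gamma$ if for every two distinct vertices $u,v\in V(\Gamma)\setminus L_D$ we have $\emptyset\ne N(u)\cap L_D\ne N(v)\cap L_D\ne\emptyset$ (i.e. both intersections are non-empty and they are different from each other). A locating-dominating set is minimal if it is minimal with respect to inclusion among locating-dominating sets. Exchange property: locating-dominating sets have the exchange property in $\Gamma$ if whenever $L_{D_1}$ and $L_{D_2}$ are minimal locating-dominating sets for $\Gamma$ and $u_1\in L_{D_1}$, there exists $u_2\in L_{D_2}$ such that $(L_{D_2}\setminus\{u_2\})\cup\{u_1\}$ is also a minimal locating-dominating set. -}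

module Defs where

open import Algebra.Apartness.Bundles using (HeytingField; HeytingCommutativeRing)
open import Algebra.Bundles using (CommutativeRing)
open import Algebra.Module.Bundles using (Module)
import Algebra.Properties.CommutativeMonoid.Sum as Sum
import Algebra.Properties.Group as GroupProperties
open import Data.Bool.Base using (Bool; true; _∧_; _∨_; not)
open import Data.Fin.Base using (Fin)
import Data.Fin.Properties as Fin
open import Data.Nat.Base using (ℕ)
open import Data.Product.Base using (Σ; ∃-syntax; _×_; _,_; proj₁; proj₂)
open import Data.Vec.Functional using (Vector)
open import Function.Bundles using (Func; Inverse; _⟨$⟩_; mk⇔)
open import Function.Properties.Inverse using (Inverse⇒Injection)
open import Level using (Level; _⊔_; suc; 0ℓ)
open import Relation.Binary.Bundles using (Setoid; DecSetoid)
open import Relation.Binary.Core using (Rel)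
open import Relation.Binary.Definitions using (Symmetric; Irreflexive; _Respects₂_; Decidable)
import Relation.Binary.Construct.On as On
import Relation.Binary.PropositionalEquality as ≡
open import Relation.Binary.PropositionalEquality using (_≡_)
open import Relation.Nullary using (¬_)
open import Relation.Nullary.Decidable using (does; does-⇔; map′; via-injection)
open import Relation.Unary using (Pred; _∩_; _⊆_; _≐_; Satisfiable)

private variable
  a c ℓ ℓ₁ ℓ₂ m ℓm : Level

record SimpleGraph v ℓ e : Set (suc (v ⊔ ℓ ⊔ e)) where
  field
    vertices  : DecSetoid v ℓ

  open DecSetoid vertices public renaming (Carrier to Vertex)

  field
    Adj        : Rel Vertex e
    Adj-resp   : Adj Respects₂ _≈_
    Adj-sym    : Symmetric Adj
    Adj-irrefl : Irreflexive _≈_ Adj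

module LocatingDomination {v ℓ e} (G : SimpleGraph v ℓ e) where
  open SimpleGraph G

  N : Vertex → Pred Vertex e
  N u w = Adj u w

  -- Sets of vertices are given by characteristic functions compatible
  -- with equality of vertices; on a finite vertex set these are all the
  -- subsets, as for Data.Fin.Subset.
  VertexSet : Set (v ⊔ ℓ)
  VertexSet = Func setoid (≡.setoid Bool)

  infix 4 _∈_ _∉_
  _∈_ _∉_ : Vertex → VertexSet → Set
  u ∈ L = L ⟨$⟩ u ≡ true
  u ∉ L = ¬ (u ∈ L)

  ⟦_⟧ : VertexSet → Pred Vertex 0ℓ
  ⟦ L ⟧ u = u ∈ L

  ⁅_⁆ : Vertex → VertexSet
  ⁅ u ⁆ = record
    { to   = λ x → does (x ≟ u)
    ; cong = λ {x} {y} x≈y →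
        does-⇔ (mk⇔ (trans (sym x≈y)) (trans x≈y)) (x ≟ u) (y ≟ u)
    }

  infixl 7 _∖_
  infixl 6 _∪_
  _∪_ _∖_ : VertexSet → VertexSet → VertexSet
  K ∪ L = record
    { to   = λ x → (K ⟨$⟩ x) ∨ (L ⟨$⟩ x)
    ; cong = λ x≈y → ≡.cong₂ _∨_ (Func.cong K x≈y) (Func.cong L x≈y)
    }
  K ∖ L = record
    { to   = λ x → (K ⟨$⟩ x) ∧ not (L ⟨$⟩ x)
    ; cong = λ x≈y → ≡.cong₂ (λ p q → p ∧ not q) (Func.cong K x≈y) (Func.cong L x≈y)
    }

  IsLocatingDominating : VertexSet → Set (v ⊔ ℓ ⊔ e)
  IsLocatingDominating L =
    ∀ u v → u ≉ v → u ∉ L → v ∉ L →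
      Satisfiable (N u ∩ ⟦ L ⟧)
      × ¬ ((N u ∩ ⟦ L ⟧) ≐ (N v ∩ ⟦ L ⟧))
      × Satisfiable (N v ∩ ⟦ L ⟧)

  IsMinimalLocatingDominating : VertexSet → Set (v ⊔ ℓ ⊔ e)
  IsMinimalLocatingDominating L =
    IsLocatingDominating L
    × (∀ K → IsLocatingDominating K → ⟦ K ⟧ ⊆ ⟦ L ⟧ → ⟦ L ⟧ ⊆ ⟦ K ⟧)

  ExchangeProperty : Set (v ⊔ ℓ ⊔ e)
  ExchangeProperty =
    ∀ L₁ L₂ → IsMinimalLocatingDominating L₁ → IsMinimalLocatingDominating L₂ →
    ∀ u₁ → u₁ ∈ L₁ →
    ∃[ u₂ ] u₂ ∈ L₂ × IsMinimalLocatingDominating ((L₂ ∖ ⁅ u₂ ⁆) ∪ ⁅ u₁ ⁆)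

open LocatingDomination public using (ExchangeProperty)

HasSize : Setoid a ℓ → ℕ → Set (a ⊔ ℓ)
HasSize S q = Inverse S (≡.setoid (Fin q))

-- Over a field with finitely many elements equality is decidable, and
-- the apartness of the Heyting field coincides with _≉_: invertibility
-- of x - y can be decided by search, and the apartness is tight.
HasOrder : HeytingField c ℓ₁ ℓ₂ → ℕ → Set (c ⊔ ℓ₁)
HasOrder F q = HasSize (HeytingField.setoid F) q

VectorSpace : HeytingField c ℓ₁ ℓ₂ → ∀ m ℓm → Set (c ⊔ ℓ₁ ⊔ suc (m ⊔ ℓm))
VectorSpace F = Module
  (HeytingCommutativeRing.commutativeRing (HeytingField.heytingCommutativeRing F))

module _ (F : HeytingField c ℓ₁ ℓ₂) (V : VectorSpace F m ℓm) where
  open HeytingField F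
  open Module V
  open Sum +ᴹ-commutativeMonoid using (sum; sum-cong-≋; ∑-distrib-+)

  linearCombination : ∀ {n} → Vector Carrier n → Vector Carrierᴹ n → Carrierᴹ
  linearCombination x b = sum (λ i → x i *ₗ b i)

  Spans : ∀ {n} → Vector Carrierᴹ n → Set (c ⊔ m ⊔ ℓm)
  Spans b = ∀ v → ∃[ x ] v ≈ᴹ linearCombination x b

  LinearlyIndependent : ∀ {n} → Vector Carrierᴹ n → Set (c ⊔ ℓ₁ ⊔ ℓm)
  LinearlyIndependent b = ∀ x → linearCombination x b ≈ᴹ 0ᴹ → ∀ i → x i ≈ 0#

  record IsBasis {n} (b : Vector Carrierᴹ n) : Set (c ⊔ ℓ₁ ⊔ m ⊔ ℓm) where
    field
      spans               : Spans b
      linearlyIndependent : LinearlyIndependent b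

    coeff : Carrierᴹ → Vector Carrier n
    coeff v = proj₁ (spans v)

    coeff-expansion : ∀ v → v ≈ᴹ linearCombination (coeff v) b
    coeff-expansion v = proj₂ (spans v)

    linearCombination-injective : ∀ x y →
      linearCombination x b ≈ᴹ linearCombination y b → ∀ i → x i ≈ y i
    linearCombination-injective x y eq i =
      x∙y⁻¹≈ε⇒x≈y (x i) (y i) (linearlyIndependent (λ j → x j - y j) lemma i)
      where
      open CommutativeRing
        (HeytingCommutativeRing.commutativeRing (HeytingField.heytingCommutativeRing F))
        using (+-group)
      open GroupProperties +-group using (x∙y⁻¹≈ε⇒x≈y; //-rightDividesˡ)
      open GroupProperties +ᴹ-group using (identityˡ-unique)

      split : linearCombination (λ j → x j - y j) b +ᴹ linearCombination y b
              ≈ᴹ linearCombination x b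
      split = ≈ᴹ-trans
        (≈ᴹ-sym (∑-distrib-+ (λ j → (x j - y j) *ₗ b j) (λ j → y j *ₗ b j)))
        (sum-cong-≋ λ j → ≈ᴹ-trans (≈ᴹ-sym (*ₗ-distribʳ (b j) (x j - y j) (y j)))
                                   (*ₗ-cong (//-rightDividesˡ (y j) (x j)) ≈ᴹ-refl))

      lemma : linearCombination (λ j → x j - y j) b ≈ᴹ 0ᴹ
      lemma = identityˡ-unique _ _ (≈ᴹ-trans split eq)

    coeff-unique : ∀ v x → v ≈ᴹ linearCombination x b → ∀ i → coeff v i ≈ x i
    coeff-unique v x eq =
      linearCombination-injective (coeff v) x (≈ᴹ-trans (≈ᴹ-sym (coeff-expansion v)) eq)

    coeff-cong : ∀ {u v} → u ≈ᴹ v → ∀ i → coeff u i ≈ coeff v i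
    coeff-cong {u} {v} u≈v = coeff-unique u (coeff v) (≈ᴹ-trans u≈v (coeff-expansion v))

    coeff-injective : ∀ {u v} → (∀ i → coeff u i ≈ coeff v i) → u ≈ᴹ v
    coeff-injective {u} {v} eq = ≈ᴹ-trans (coeff-expansion u)
      (≈ᴹ-trans (sum-cong-≋ λ i → *ₗ-cong (eq i) ≈ᴹ-refl) (≈ᴹ-sym (coeff-expansion v)))

module _ (F : HeytingField c ℓ₁ ℓ₂) {q} (∣F∣≡q : HasOrder F q)
         (V : VectorSpace F m ℓm)
         {n} {b : Vector (Module.Carrierᴹ V) n} (basis : IsBasis F V b) where
  open HeytingField F
  open Module V
  open IsBasis basis

  _≟ᶠ_ : Decidable _≈_
  _≟ᶠ_ = via-injection (Inverse⇒Injection ∣F∣≡q) Fin._≟_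

  _≟ᴹ_ : Decidable _≈ᴹ_
  u ≟ᴹ v = map′ coeff-injective coeff-cong (Fin.all? λ i → coeff u i ≟ᶠ coeff v i)

  vectors : DecSetoid m ℓm
  vectors = record
    { isDecEquivalence = record { isEquivalence = ≈ᴹ-isEquivalence ; _≟_ = _≟ᴹ_ } }

  NonZeroVector : Set (m ⊔ ℓm)
  NonZeroVector = Σ Carrierᴹ λ v → ¬ (v ≈ᴹ 0ᴹ)

  NonZeroComponentAdj : Rel NonZeroVector (ℓ₁ ⊔ ℓm)
  NonZeroComponentAdj (u , _) (v , _) =
    ¬ (u ≈ᴹ v) × ∃[ i ] ¬ (coeff u i ≈ 0#) × ¬ (coeff v i ≈ 0#)

  nonZeroComponentGraph : SimpleGraph (m ⊔ ℓm) ℓm (ℓ₁ ⊔ ℓm)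
  nonZeroComponentGraph = record
    { vertices   = On.decSetoid vectors proj₁
    ; Adj        = NonZeroComponentAdj
    ; Adj-resp   =
        (λ v≈w (u≉v , i , uᵢ≉0 , vᵢ≉0) →
          (λ u≈w → u≉v (≈ᴹ-trans u≈w (≈ᴹ-sym v≈w))) ,
          i , uᵢ≉0 , (λ wᵢ≈0 → vᵢ≉0 (trans (coeff-cong v≈w i) wᵢ≈0))) ,
        (λ v≈w (v≉u , i , vᵢ≉0 , uᵢ≉0) →
          (λ w≈u → v≉u (≈ᴹ-trans v≈w w≈u)) ,
          i , (λ wᵢ≈0 → vᵢ≉0 (trans (coeff-cong v≈w i) wᵢ≈0)) , uᵢ≉0)
    ; Adj-sym    = λ (u≉v , i , uᵢ≉0 , vᵢ≉0) → (λ v≈u → u≉v (≈ᴹ-sym v≈u)) , i , vᵢ≉0 , uᵢ≉0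
    ; Adj-irrefl = λ u≈v (u≉v , _) → u≉v u≈v
    }

{-# OPTIONS --safe #-}
-- Two non-zero vectors with the same support have the same neighbours other
-- than themselves, so a locating-dominating set misses at most one vector of
-- each support class.  Conversely, as q ≥ 3 every class has at least two
-- elements, so a set L missing at most one vector of each class meets every
-- class: this gives domination, and N(u) ∩ L determines the support of u
-- because coordinate i lies in it iff u is adjacent to the vectors of L with
-- support {i}.  The locating-dominating sets are thus the sets missing at most
-- one vector per class, and exchanging u₁ ∉ L₂ for a vector of its own class
-- preserves minimality.
module Submission where

open import Defs
open import Algebra.Apartness.Bundles using (HeytingField; HeytingCommutativeRing)
open import Algebra.Bundles using (CommutativeRing)
open import Algebra.Module.Bundles using (Module)
import Algebra.Apartness.Properties.HeytingCommutativeRing as HeytingProperties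
import Algebra.Properties.CommutativeMonoid.Sum as Sum
import Algebra.Properties.Group as GroupProperties
import Algebra.Properties.Ring as RingProperties
import Data.Bool.Properties as Bool
open import Data.Bool.Base using (true)
open import Data.Fin.Base using (Fin; zero; suc)
import Data.Fin.Properties as Fin
open import Data.Nat.Base using (ℕ; _≥_; s≤s)
open import Data.Product.Base using (∃-syntax; _×_; _,_; proj₁; proj₂)
open import Data.Sum.Base using (_⊎_; inj₁; inj₂; [_,_]′)
open import Data.Vec.Functional using (Vector; replicate; updateAt)
open import Data.Vec.Functional.Properties using (updateAt-updates; updateAt-minimal)
open import Function.Base using (_∘_; const)
open import Function.Bundles using (Func; Inverse; _⟨$⟩_; _⇔_; mk⇔; Equivalence)
open import Level using (Level)
open import Relation.Binary.Core using (Rel)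
import Relation.Binary.PropositionalEquality as ≡
open import Relation.Binary.PropositionalEquality using (_≡_; _≢_)
open import Relation.Binary.Structures using (IsEquivalence)
open import Relation.Nullary using (¬_; Dec; yes; no; contradiction)
open import Relation.Nullary.Decidable using (decidable-stable; toSum)
open import Relation.Unary using (_⊆_; _≐_)

private variable
  c ℓ₁ ℓ₂ m ℓm : Level

-- Vertex sets after exchanging one vertex for another.

module LocatingExchange {v ℓ e} (G : SimpleGraph v ℓ e) where
  open SimpleGraph G
  open LocatingDomination G hiding (ExchangeProperty)

  _∈?_ : ∀ u L → Dec (u ∈ L)
  u ∈? L = (L ⟨$⟩ u) Bool.≟ true

  ∈∧∉⇒≉ : ∀ L {u v} → u ∈ L → v ∉ L → v ≉ u
  ∈∧∉⇒≉ L u∈L v∉L v≈u = v∉L (≡.trans (Func.cong L v≈u) u∈L)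

  exchange : VertexSet → Vertex → Vertex → VertexSet
  exchange L a b = (L ∖ ⁅ a ⁆) ∪ ⁅ b ⁆

  ∈-exchange⁺ˡ : ∀ L {a b x} → x ∈ L → x ≉ a → x ∈ exchange L a b
  ∈-exchange⁺ˡ L {a} {b} {x} x∈L x≉a with x ≟ a
  ... | yes x≈a = contradiction x≈a x≉a
  ... | no _ rewrite x∈L = ≡.refl

  ∈-exchange⁺ʳ : ∀ L {a b x} → x ≈ b → x ∈ exchange L a b
  ∈-exchange⁺ʳ L {a} {b} {x} x≈b with x ≟ b
  ... | yes _  = Bool.∨-zeroʳ _
  ... | no x≉b = contradiction x≈b x≉b

  ∈-exchange⁻ : ∀ L {a b x} → x ∈ exchange L a b → (x ∈ L × x ≉ a) ⊎ x ≈ b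
  ∈-exchange⁻ L {a} {b} {x} x∈ with x ≟ b
  ... | yes x≈b = inj₂ x≈b
  ... | no _ with L ⟨$⟩ x | x ≟ a
  -- In every other combination the membership hypothesis reduces to `false ≡ true`.
  ...   | true | no x≉a = inj₁ (≡.refl , x≉a)

  ∉-exchange⁻ : ∀ L {a b x} → x ∉ exchange L a b → x ∉ L ⊎ x ≈ a
  ∉-exchange⁻ L {a} {b} {x} x∉ =
    [ inj₂ , (λ x≉a → inj₁ λ x∈L → x∉ (∈-exchange⁺ˡ L {a} {b} x∈L x≉a)) ]′ (toSum (x ≟ a))

  -- Exchange when locating-domination is governed by an equivalence of vertices.

  module TwinClasses {r} {_∼_ : Rel Vertex r} (∼-isEquivalence : IsEquivalence _∼_)
                     (≈⇒∼ : ∀ u v → u ≈ v → u ∼ v) where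

    private module ∼ = IsEquivalence ∼-isEquivalence

    MissesAtMostOnePerClass : VertexSet → Set _
    MissesAtMostOnePerClass L = ∀ {u v} → u ∼ v → u ∉ L → v ∉ L → u ≈ v

    missesAtMostOne-⊆ : ∀ K L → ⟦ K ⟧ ⊆ ⟦ L ⟧ →
      MissesAtMostOnePerClass K → MissesAtMostOnePerClass L
    missesAtMostOne-⊆ K L K⊆L miss u∼v u∉L v∉L = miss u∼v (u∉L ∘ K⊆L) (v∉L ∘ K⊆L)

    -- In their common class `L` misses only `b`, so after the exchange only `a` is missed there:
    -- any other missed member would lie outside `L` and hence equal `b`, which now belongs to the
    -- set.
    missesAtMostOne-exchange : ∀ L {a b} → a ∼ b → b ∉ L →
      MissesAtMostOnePerClass L → MissesAtMostOnePerClass (exchange L a b)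
    missesAtMostOne-exchange L {a} {b} a∼b b∉L miss {x} {y} x∼y x∉ y∉
      with ∉-exchange⁻ L x∉ | ∉-exchange⁻ L y∉
    ... | inj₁ x∉L | inj₁ y∉L = miss x∼y x∉L y∉L
    ... | inj₂ x≈a | inj₂ y≈a = trans x≈a (sym y≈a)
    ... | inj₂ x≈a | inj₁ y∉L = contradiction
          (∈-exchange⁺ʳ L (miss (∼.trans (∼.sym x∼y) (∼.trans (≈⇒∼ x a x≈a) a∼b)) y∉L b∉L)) y∉
    ... | inj₁ x∉L | inj₂ y≈a = contradiction
          (∈-exchange⁺ʳ L (miss (∼.trans x∼y (∼.trans (≈⇒∼ y a y≈a) a∼b)) x∉L b∉L)) x∉

    module _
      (locating⇔ : ∀ L → IsLocatingDominating L ⇔ MissesAtMostOnePerClass L)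
      where

      private
        locating⇒ : ∀ L → IsLocatingDominating L → MissesAtMostOnePerClass L
        locating⇒ L = Equivalence.to (locating⇔ L)

        locating⇐ : ∀ L → MissesAtMostOnePerClass L → IsLocatingDominating L
        locating⇐ L = Equivalence.from (locating⇔ L)

      -- Serves the exchange of a vertex of `L` for itself, whose result has the same members as `L`
      -- without being definitionally the same characteristic function.
      isMinimal-resp-≐ : ∀ K L → ⟦ K ⟧ ≐ ⟦ L ⟧ →
        IsMinimalLocatingDominating K → IsMinimalLocatingDominating L
      isMinimal-resp-≐ K L (K⊆L , L⊆K) (K-ld , K-min) =
        locating⇐ L (missesAtMostOne-⊆ K L K⊆L (locating⇒ K K-ld)) ,
        λ M M-ld M⊆L x∈L → K-min M M-ld (λ x∈M → L⊆K (M⊆L x∈M)) (L⊆K x∈L)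

      isMinimal-exchange : ∀ L {a b} → a ∼ b → a ∈ L → b ∉ L →
        IsMinimalLocatingDominating L → IsMinimalLocatingDominating (exchange L a b)
      isMinimal-exchange L {a} {b} a∼b a∈L b∉L (L-ld , L-min) =
        locating⇐ L′ (missesAtMostOne-exchange L a∼b b∉L (locating⇒ L L-ld)) , minimal
        where
        L′ = exchange L a b

        a≉b : a ≉ b
        a≉b = ∈∧∉⇒≉ L a∈L b∉L ∘ sym

        a∉L′ : a ∉ L′
        a∉L′ a∈L′ = [ (λ (_ , a≉a) → a≉a refl) , a≉b ]′ (∈-exchange⁻ L a∈L′)

        -- Exchanging back turns K ⊆ L′ into K′ ⊆ L, to which minimality of L applies.
        minimal : ∀ K → IsLocatingDominating K → ⟦ K ⟧ ⊆ ⟦ L′ ⟧ → ⟦ L′ ⟧ ⊆ ⟦ K ⟧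
        minimal K K-ld K⊆L′ {x} x∈L′ = [ fromL , fromb ]′ (∈-exchange⁻ L x∈L′)
          where
          K-miss = locating⇒ K K-ld
          K′ = exchange K b a

          a∉K : a ∉ K
          a∉K a∈K = a∉L′ (K⊆L′ a∈K)

          K′⊆L : ⟦ K′ ⟧ ⊆ ⟦ L ⟧
          K′⊆L y∈K′ with ∈-exchange⁻ K y∈K′
          ... | inj₂ y≈a = ≡.trans (Func.cong L y≈a) a∈L
          ... | inj₁ (y∈K , y≉b) with ∈-exchange⁻ L (K⊆L′ y∈K)
          ...   | inj₁ (y∈L , _) = y∈L
          ...   | inj₂ y≈b       = contradiction y≈b y≉b

          fromL : x ∈ L × x ≉ a → x ∈ K
          fromL (x∈L , x≉a) with ∈-exchange⁻ K (L-min K′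
            (locating⇐ K′ (missesAtMostOne-exchange K (∼.sym a∼b) a∉K K-miss)) K′⊆L x∈L)
          ... | inj₁ (x∈K , _) = x∈K
          ... | inj₂ x≈a       = contradiction x≈a x≉a

          fromb : x ≈ b → x ∈ K
          -- `K` already misses `a`, so it can miss no other member of that class, in particular not
          -- `b`.
          fromb x≈b = decidable-stable (x ∈? K) λ x∉K →
            a≉b (trans (K-miss (∼.trans a∼b (≈⇒∼ b x (sym x≈b))) a∉K x∉K) x≈b)

      exchangeProperty : (∀ u → ∃[ v ] u ∼ v × u ≉ v) → ExchangeProperty G
      exchangeProperty twin _ L _ L-minimal u _ with u ∈? L
      ... | yes u∈L = u , u∈L , isMinimal-resp-≐ L (exchange L u u) (L⊆ , ⊆L) L-minimal
        where
        L⊆ : ⟦ L ⟧ ⊆ ⟦ exchange L u u ⟧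
        L⊆ {x} x∈L = [ ∈-exchange⁺ʳ L {u} {u} , ∈-exchange⁺ˡ L x∈L ]′ (toSum (x ≟ u))
        ⊆L : ⟦ exchange L u u ⟧ ⊆ ⟦ L ⟧
        ⊆L x∈ = [ proj₁ , (λ x≈u → ≡.trans (Func.cong L x≈u) u∈L) ]′ (∈-exchange⁻ L x∈)
      -- `L` misses `u`, so it must contain the twin `v`, which is the vertex to give up.
      ... | no u∉L = let v , u∼v , u≉v = twin u
                         v∈L = decidable-stable (v ∈? L) λ v∉L →
                                 u≉v (locating⇒ L (proj₁ L-minimal) u∼v u∉L v∉L)
                     in v , v∈L , isMinimal-exchange L (∼.sym u∼v) v∈L u∉L L-minimal

-- Non-zero scalars in a finite field.

third-element : ∀ {q} → q ≥ 3 → (i j : Fin q) → ∃[ k ] k ≢ i × k ≢ j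
third-element (s≤s (s≤s (s≤s _))) (suc _)       (suc _)       = zero , (λ ()) , λ ()
third-element (s≤s (s≤s (s≤s _))) zero          zero          = suc zero , (λ ()) , λ ()
third-element (s≤s (s≤s (s≤s _))) zero          (suc zero)    = suc (suc zero) , (λ ()) , λ ()
third-element (s≤s (s≤s (s≤s _))) zero          (suc (suc _)) = suc zero , (λ ()) , λ ()
third-element (s≤s (s≤s (s≤s _))) (suc zero)    zero          = suc (suc zero) , (λ ()) , λ ()
third-element (s≤s (s≤s (s≤s _))) (suc (suc _)) zero          = suc zero , (λ ()) , λ ()

module _ (F : HeytingField c ℓ₁ ℓ₂) where
  open HeytingField F
  open CommutativeRing
    (HeytingCommutativeRing.commutativeRing heytingCommutativeRing)
    using (ring; +-group)
  open HeytingProperties heytingCommutativeRing using (x#0y#0→xy#0)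
  open GroupProperties +-group using (x∙y⁻¹≈ε⇒x≈y)
  open RingProperties ring using ([y-z]x≈yx-zx)

  -- The product rule for the field concerns apartness. Tightness turns `¬ x ≈ 0#` only into the
  -- double negation of `x # 0#`, which suffices because the goal is itself a negation.
  *-nonZero : ∀ {x y} → ¬ x ≈ 0# → ¬ y ≈ 0# → ¬ x * y ≈ 0#
  *-nonZero {x} {y} x≉0 y≉0 xy≈0 =
    x≉0 (proj₁ (tight x 0#) λ x#0 → y≉0 (proj₁ (tight y 0#) λ y#0 →
      proj₂ (tight (x * y) 0#) xy≈0 (x#0y#0→xy#0 x#0 y#0)))

  -- Otherwise `(x - 1#) * y ≈ 0#` with both factors non-zero.
  x*y≉y : ∀ {x y} → ¬ x ≈ 1# → ¬ y ≈ 0# → ¬ x * y ≈ y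
  x*y≉y {x} {y} x≉1 y≉0 xy≈y = *-nonZero (x≉1 ∘ x∙y⁻¹≈ε⇒x≈y x 1#) y≉0
    (trans ([y-z]x≈yx-zx y x 1#)
      (trans (+-cong xy≈y (-‿cong (*-identityˡ y))) (-‿inverseʳ y)))

  -- Supplies the scalar that moves a non-zero vector inside its support class; this is where
  -- `q ≥ 3` enters.
  ∃≉0≉1 : ∀ {q} → HasOrder F q → q ≥ 3 → ∃[ a ] ¬ a ≈ 0# × ¬ a ≈ 1#
  ∃≉0≉1 ∣F∣≡q q≥3 =
    let k , k≢0 , k≢1 = third-element q≥3 (to 0#) (to 1#)
    in from k , avoids k≢0 , avoids k≢1
    where
    open Inverse ∣F∣≡q
    avoids : ∀ {k x} → k ≢ to x → ¬ from k ≈ x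
    avoids k≢x eq = k≢x (≡.trans (≡.sym (strictlyInverseˡ _)) (to-cong eq))

-- Coefficients with respect to the basis.

module _ (F : HeytingField c ℓ₁ ℓ₂) (V : VectorSpace F m ℓm) where
  open Module V
  open Sum +ᴹ-commutativeMonoid using (sum)

  *ₗ-distribˡ-sum : ∀ a {k} (xs : Vector Carrierᴹ k) → a *ₗ sum xs ≈ᴹ sum (λ i → a *ₗ xs i)
  *ₗ-distribˡ-sum a {ℕ.zero}  xs = *ₗ-zeroʳ a
  *ₗ-distribˡ-sum a {ℕ.suc k} xs = ≈ᴹ-trans (*ₗ-distribˡ a _ _)
    (+ᴹ-congˡ (*ₗ-distribˡ-sum a (xs ∘ suc)))

module _ (F : HeytingField c ℓ₁ ℓ₂) (V : VectorSpace F m ℓm)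
         {n} {b : Vector (Module.Carrierᴹ V) n} (basis : IsBasis F V b) where
  open HeytingField F
  open Module V
  open IsBasis basis
  open Sum +ᴹ-commutativeMonoid using (sum-cong-≋)

  coeff-*ₗ : ∀ a v i → coeff (a *ₗ v) i ≈ a * coeff v i
  coeff-*ₗ a v = coeff-unique (a *ₗ v) (λ i → a * coeff v i)
    (≈ᴹ-trans (*ₗ-congˡ (coeff-expansion v))
      (≈ᴹ-trans (*ₗ-distribˡ-sum F V a (λ i → coeff v i *ₗ b i))
        (sum-cong-≋ λ i → ≈ᴹ-sym (*ₗ-assoc a (coeff v i) (b i)))))

  coeff-0ᴹ : ∀ i → coeff 0ᴹ i ≈ 0#
  coeff-0ᴹ = linearlyIndependent (coeff 0ᴹ) (≈ᴹ-sym (coeff-expansion 0ᴹ))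

  coeff≉0⇒≉0ᴹ : ∀ {v i} → ¬ coeff v i ≈ 0# → ¬ v ≈ᴹ 0ᴹ
  coeff≉0⇒≉0ᴹ {i = i} vᵢ≉0 v≈0 = vᵢ≉0 (trans (coeff-cong v≈0 i) (coeff-0ᴹ i))

  coeff-linearCombination : ∀ x i → coeff (linearCombination F V x b) i ≈ x i
  coeff-linearCombination x = coeff-unique _ x ≈ᴹ-refl

-- Supports, twins and locating-domination in the non-zero component graph.

module _ (F : HeytingField c ℓ₁ ℓ₂) {q} (∣F∣≡q : HasOrder F q) (q≥3 : q ≥ 3)
         (V : VectorSpace F m ℓm)
         {n} {b : Vector (Module.Carrierᴹ V) n} (basis : IsBasis F V b) where
  open HeytingField F using (0#; trans; sym; reflexive) renaming (_≈_ to _≈ᶠ_)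
  open Module V
  open IsBasis basis

  private
    Γ = nonZeroComponentGraph F ∣F∣≡q V basis

  open SimpleGraph Γ using (Vertex; Adj; _≈_; _≉_; _≟_)
  open LocatingDomination Γ hiding (ExchangeProperty)

  infix 4 _∈supp_ _∼_

  _∈supp_ : Fin n → Vertex → Set _
  i ∈supp (v , _) = ¬ coeff v i ≈ᶠ 0#

  _∼_ : Rel Vertex _
  u ∼ v = ∀ i → (i ∈supp u → i ∈supp v) × (i ∈supp v → i ∈supp u)

  ∼-isEquivalence : IsEquivalence _∼_
  ∼-isEquivalence = record
    { refl  = λ _ → (λ p → p) , λ p → p
    ; sym   = λ u∼v i → proj₂ (u∼v i) , proj₁ (u∼v i)
    ; trans = λ u∼v v∼w i → proj₁ (v∼w i) ∘ proj₁ (u∼v i) , proj₂ (u∼v i) ∘ proj₂ (v∼w i)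
    }

  ≈⇒∼ : ∀ u v → u ≈ v → u ∼ v
  ≈⇒∼ _ _ u≈v i = (λ uᵢ≉0 vᵢ≈0 → uᵢ≉0 (trans (coeff-cong u≈v i) vᵢ≈0)) ,
                  (λ vᵢ≉0 uᵢ≈0 → vᵢ≉0 (trans (sym (coeff-cong u≈v i)) uᵢ≈0))

  open LocatingExchange Γ
  open TwinClasses ∼-isEquivalence ≈⇒∼

  nonEmptySupport : ∀ u → ∃[ i ] i ∈supp u
  nonEmptySupport (u , u≉0) = Fin.¬∀⟶∃¬ n _ (λ i → _≟ᶠ_ F ∣F∣≡q V basis (coeff u i) 0#)
    λ uᵢ≈0 → u≉0 (coeff-injective λ i → trans (uᵢ≈0 i) (sym (coeff-0ᴹ F V basis i)))

  -- Scaling by some `a` other than `0#` and `1#` keeps the support and changes every non-zero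
  -- coefficient.
  twin : ∀ u → ∃[ v ] u ∼ v × u ≉ v
  twin u@(x , _) =
    let i , xᵢ≉0      = nonEmptySupport u
        a , a≉0 , a≉1 = ∃≉0≉1 F ∣F∣≡q q≥3
        coeff-ax      = coeff-*ₗ F V basis a x
        ⊆supp : ∀ j → ¬ coeff x j ≈ᶠ 0# → ¬ coeff (a *ₗ x) j ≈ᶠ 0#
        ⊆supp j xⱼ≉0 axⱼ≈0 = *-nonZero F a≉0 xⱼ≉0 (trans (sym (coeff-ax j)) axⱼ≈0)
    in (a *ₗ x , coeff≉0⇒≉0ᴹ F V basis (⊆supp i xᵢ≉0)) ,
       (λ j → ⊆supp j , λ axⱼ≉0 xⱼ≈0 →
         axⱼ≉0 (trans (coeff-ax j) (trans (*-congˡ xⱼ≈0) (zeroʳ a)))) ,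
       λ x≈ax → x*y≉y F a≉1 xᵢ≉0 (trans (sym (coeff-ax i)) (sym (coeff-cong x≈ax i)))
    where open HeytingField F using (*-congˡ; zeroʳ)

  -- The witness is the component of `u` along `b i`; taking `coeff u i` as the scalar gives one
  -- already known to be non-zero.
  singletonSupport : ∀ u i → i ∈supp u → ∃[ w ] i ∈supp w × (∀ j → j ∈supp w → j ≡ i)
  singletonSupport (u , _) i uᵢ≉0 =
    (linearCombination F V x b , coeff≉0⇒≉0ᴹ F V basis wᵢ≉0) , wᵢ≉0 ,
    λ j wⱼ≉0 → decidable-stable (j Fin.≟ i) λ j≢i → wⱼ≉0
      (trans (coeff-x j) (reflexive (updateAt-minimal j i (replicate n 0#) j≢i)))
    where
    x = updateAt (replicate n 0#) i (const (coeff u i))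
    coeff-x = coeff-linearCombination F V basis x
    wᵢ≉0 : ¬ coeff (linearCombination F V x b) i ≈ᶠ 0#
    wᵢ≉0 wᵢ≈0 = uᵢ≉0 (trans
      (sym (trans (coeff-x i) (reflexive (updateAt-updates i (replicate n 0#))))) wᵢ≈0)

  ∼⇒Adj : ∀ u v → u ∼ v → u ≉ v → Adj u v
  ∼⇒Adj u v u∼v u≉v = let i , uᵢ≉0 = nonEmptySupport u in u≉v , i , uᵢ≉0 , proj₁ (u∼v i) uᵢ≉0

  locating⇒missesAtMostOne : ∀ L → IsLocatingDominating L → MissesAtMostOnePerClass L
  locating⇒missesAtMostOne L ld {u} {v} u∼v u∉L v∉L = decidable-stable (u ≟ v) λ u≉v →
    proj₁ (proj₂ (ld u v u≉v u∉L v∉L))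
      (transfer u v u∼v v∉L , transfer v u (IsEquivalence.sym ∼-isEquivalence {u} {v} u∼v) u∉L)
    where
    transfer : ∀ s t → s ∼ t → t ∉ L → ∀ {w} → Adj s w × w ∈ L → Adj t w × w ∈ L
    transfer s t s∼t t∉L ((_ , i , sᵢ≉0 , wᵢ≉0) , w∈L) =
      -- Adjacency also demands distinct vertices: `w` lies in `L` and `t` does not.
      (∈∧∉⇒≉ L w∈L t∉L , i , proj₁ (s∼t i) sᵢ≉0 , wᵢ≉0) , w∈L

  missesAtMostOne⇒locating : ∀ L → MissesAtMostOnePerClass L → IsLocatingDominating L
  missesAtMostOne⇒locating L miss u v u≉v u∉L v∉L =
    dominated u u∉L ,
    (λ (Nu⊆Nv , Nv⊆Nu) →
      u≉v (miss {u} {v} (λ i → supp⊆ u v u∉L Nu⊆Nv i , supp⊆ v u v∉L Nv⊆Nu i) u∉L v∉L)) ,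
    dominated v v∉L
    where
    -- If `L` misses `w`, it cannot miss the twin of `w` as well.
    representative : ∀ w → ∃[ l ] w ∼ l × l ∈ L
    representative w with w ∈? L
    ... | yes w∈L = w , IsEquivalence.refl ∼-isEquivalence {w} , w∈L
    ... | no w∉L  =
      let w′ , w∼w′ , w≉w′ = twin w
      in w′ , w∼w′ , decidable-stable (w′ ∈? L) λ w′∉L → w≉w′ (miss w∼w′ w∉L w′∉L)

    dominated : ∀ w → w ∉ L → ∃[ l ] Adj w l × l ∈ L
    dominated w w∉L =
      let l , w∼l , l∈L = representative w
      in l , ∼⇒Adj w l w∼l (∈∧∉⇒≉ L l∈L w∉L) , l∈L

    -- A vector `l` of `L` with support exactly `i` tests for that coordinate: it is a neighbour of
    -- `s`, hence of `t`, and `i` is the only coordinate it can share with `t`.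
    supp⊆ : ∀ s t → s ∉ L → (∀ {w} → Adj s w × w ∈ L → Adj t w × w ∈ L) →
            ∀ i → i ∈supp s → i ∈supp t
    supp⊆ s t s∉L Ns⊆Nt i sᵢ≉0 =
      let w , wᵢ≉0 , w⊆[i] = singletonSupport s i sᵢ≉0
          l , w∼l , l∈L    = representative w
          (_ , j , tⱼ≉0 , lⱼ≉0) , _ =
            Ns⊆Nt ((∈∧∉⇒≉ L l∈L s∉L , i , sᵢ≉0 , proj₁ (w∼l i) wᵢ≉0) , l∈L)
      in ≡.subst (_∈supp t) (w⊆[i] j (proj₂ (w∼l j) lⱼ≉0)) tⱼ≉0

  exchangeProperty-nonZeroComponentGraph : ExchangeProperty Γ
  exchangeProperty-nonZeroComponentGraph = exchangeProperty
    (λ L → mk⇔ (locating⇒missesAtMostOne L) (missesAtMostOne⇒locating L)) twin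

lemma2p13 : ∀ {c ℓ₁ ℓ₂ m ℓm} (F : HeytingField c ℓ₁ ℓ₂) (q : ℕ) (∣F∣≡q : HasOrder F q)
    (V : VectorSpace F m ℓm) (n : ℕ) → n ≥ 1 →
    (b : Vector (Module.Carrierᴹ V) n) (basis : IsBasis F V b) →
    q ≥ 3 →
    ExchangeProperty (nonZeroComponentGraph F ∣F∣≡q V basis)
lemma2p13 F q ∣F∣≡q V n _ b basis q≥3 =
  exchangeProperty-nonZeroComponentGraph F ∣F∣≡q q≥3 V basis
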